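{- Let $f:\mathbb{Z}^{+}\to\mathbb{C}$ be any function, let $g_f(m)=\sum_{d\mid m} f(d)$ for $m\ge1$, and let the partial sums of $g_f$ (called its average order) be $\Sigma_{g_f,x}:=\sum_{n\le x} g_f(n)$, with $g_f(i)=0$ for $i<1$ (so $\Sigma_{g_f,x}=0$ for $x\le0$). Then for all $n\ge1$, $$\Sigma_{g_f,n+1}=\sum_{b=\pm1}\ \sum_{k=1}^{\left\lfloor\frac{\sqrt{24n+1}-b}{6}\right\rfloor+1}(-1)^{k+1}\,\Sigma_{g_f,\,n+1-k(3k+b)/2}+\sum_{k=1}^{n} a_f(k+1),$$ where the sequence $a_f$ is defined in the context.
   Context: The pair $(f,g_f)$ is related by the Lambert series $\sum_{n\ge1} \frac{f(n)q^n}{1-q^n}=\sum_{m\ge1} g_f(m)q^m$, $|q|<1$ (equivalently $g_f(m)=\sum_{d\mid m}f(d)$), with the convention $g_f(i)=0$ for $i<1$. Iverson bracket: $[P]_\delta=1$ if the condition $P$ is true and $0$ otherwise. For integers $n,i\ge 1$ define $$a_{n,i} = \sum_{b=\pm1}\ \sum_{s=0}^{\lfloor n/i\rfloor-1} (-1)^{\left\lfloor \frac{\sqrt{24(n-(s+1)i)+1}-b}{6}\right\rfloor}\left[\frac{\sqrt{24(n-(s+1)i)+1}-b}{6}\in\mathbb{Z}\right]_\delta ,$$ i.e. $a_{n,i}$ is the sum of $(-1)^k$ over all ways of writing $n=(s+1)i+\frac{k(3k\pm1)}{2}$ with integers $k,s\ge0$ (for each $s$, the value $k=0$ is counted only once,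 not once for each sign). For integers $n\ge0$ define $$a_f(n)=\sum_{i=1}^{n} f(i)\,a_{n,i}+[n=0]_\delta .$$
   Formalization: The last sum runs over k=0,…,n instead of k=1,…,n, adding the missing term a_f(1)=f(1); as printed the identity is false (f=1, n=1 gives 3=2). It is proved for f with values in any commutative ring, in particular in ℂ. -}

module Defs where

open import Algebra.Bundles using (CommutativeRing)
open import Data.Bool.Base using (if_then_else_)
open import Data.Fin.Base using (toℕ)
open import Data.Integer.Base as ℤ using (ℤ; +_; -[1+_]; 0ℤ; 1ℤ; -1ℤ; ∣_∣)
open import Data.Integer.DivMod using (_/ℕ_; [n/ℕd]*d≤n; n<s[n/ℕd]*d)
import Data.Integer.Properties as ℤ
open import Data.Nat.Base as ℕ using (ℕ; zero; suc; NonZero; z≤n; s≤s)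
open import Data.Nat.Divisibility using (_∣?_)
open import Data.Nat.DivMod using (_/_)
import Data.Nat.Properties as ℕ
open import Data.Product.Base using (∃-syntax; _×_; _,_)
open import Relation.Binary.PropositionalEquality
  using (_≡_; sym; trans; cong; subst; module ≡-Reasoning)
open import Relation.Nullary.Negation using (¬_)
open import Relation.Nullary.Decidable using (Dec; does; yes; no; map′; _×-dec_)

-- Exact integer arithmetic standing in for the real number √N.

√-step : ℕ → ℕ → ℕ
√-step n r with suc r ℕ.* suc r ℕ.≤? n
... | yes _ = suc r
... | no  _ = r

⌊√_⌋ : ℕ → ℕ
⌊√ zero ⌋ = 0
⌊√ suc n ⌋ = √-step (suc n) ⌊√ n ⌋

⌊√⌋-lower : ∀ n → ⌊√ n ⌋ ℕ.* ⌊√ n ⌋ ℕ.≤ n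
⌊√⌋-lower zero = z≤n
⌊√⌋-lower (suc n) with suc ⌊√ n ⌋ ℕ.* suc ⌊√ n ⌋ ℕ.≤? suc n
... | yes p = p
... | no  _ = ℕ.m≤n⇒m≤1+n (⌊√⌋-lower n)

⌊√⌋-upper : ∀ n → n ℕ.< suc ⌊√ n ⌋ ℕ.* suc ⌊√ n ⌋
⌊√⌋-upper zero = s≤s z≤n
⌊√⌋-upper (suc n) with suc ⌊√ n ⌋ ℕ.* suc ⌊√ n ⌋ ℕ.≤? suc n
... | yes _ = ℕ.≤-trans (s≤s (⌊√⌋-upper n))
                (ℕ.*-mono-< (ℕ.n<1+n (suc ⌊√ n ⌋)) (ℕ.n<1+n (suc ⌊√ n ⌋)))
... | no ¬p = ℕ.≰⇒> ¬p

⌊√⌋-unique : ∀ {n} r → r ℕ.* r ≡ n → r ≡ ⌊√ n ⌋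
⌊√⌋-unique {n} r r²≡n = ℕ.≤-antisym
  (ℕ.≮⇒≥ λ lt → ℕ.<⇒≱ (⌊√⌋-upper n)
    (ℕ.≤-trans (ℕ.*-mono-≤ lt lt) (ℕ.≤-reflexive r²≡n)))
  (ℕ.≮⇒≥ λ lt → ℕ.<⇒≱ (ℕ.*-mono-< lt lt)
    (ℕ.≤-trans (⌊√⌋-lower n) (ℕ.≤-reflexive (sym r²≡n))))

-- ⌊(√N − b)/6⌋.  For k ∈ ℤ, k ≤ (√N − b)/6 iff 6k + b ≤ √N iff 6k + b ≤ ⌊√N⌋,
-- as 6k + b is an integer; so √N may be replaced by ⌊√N⌋.  _/ℕ_ rounds towards −∞.
⌊[√_-_]/6⌋ : ℕ → ℤ → ℤ
⌊[√ N - b ]/6⌋ = (+ ⌊√ N ⌋ ℤ.- b) /ℕ 6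

-- x is the real number √N.
_≡√_ : ℤ → ℕ → Set
x ≡√ N = 0ℤ ℤ.≤ x × x ℤ.* x ≡ + N

-- (√N − b)/6 ∈ ℤ.
[√_-_]/6∈ℤ : ℕ → ℤ → Set
[√ N - b ]/6∈ℤ = ∃[ k ] ((+ 6 ℤ.* k ℤ.+ b) ≡√ N)

≡√⇒≡⌊√⌋ : ∀ {x N} → x ≡√ N → x ≡ + ⌊√ N ⌋
≡√⇒≡⌊√⌋ {+ r} (_ , eq) =
  cong +_ (⌊√⌋-unique r (ℤ.+-injective (trans (ℤ.pos-* r r) eq)))

/6-exact : ∀ {N b} k → (+ 6 ℤ.* k ℤ.+ b) ≡√ N → k ≡ ⌊[√ N - b ]/6⌋
/6-exact {N} {b} k p = ℤ.≤-antisym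
  (ℤ.≮⇒≥ λ lt → ℤ.<⇒≱ (ℤ.*-cancelʳ-<-nonNeg (+ 6) k*6<) (ℤ.i<j⇒suc[i]≤j lt))
  (ℤ.*-cancelʳ-≤-pos _ _ (+ 6) ≤k*6)
  where
  x : ℤ
  x = + ⌊√ N ⌋ ℤ.- b

  x≡k*6 : x ≡ k ℤ.* + 6
  x≡k*6 = begin
    + ⌊√ N ⌋ ℤ.- b               ≡⟨ cong (ℤ._- b) (≡√⇒≡⌊√⌋ p) ⟨
    (+ 6 ℤ.* k ℤ.+ b) ℤ.- b      ≡⟨ ℤ.+-assoc (+ 6 ℤ.* k) b (ℤ.- b) ⟩
    + 6 ℤ.* k ℤ.+ (b ℤ.- b)      ≡⟨ cong (ℤ._+_ (+ 6 ℤ.* k)) (ℤ.+-inverseʳ b) ⟩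
    + 6 ℤ.* k ℤ.+ 0ℤ             ≡⟨ ℤ.+-identityʳ (+ 6 ℤ.* k) ⟩
    + 6 ℤ.* k                    ≡⟨ ℤ.*-comm (+ 6) k ⟩
    k ℤ.* + 6                    ∎
    where open ≡-Reasoning

  ≤k*6 : ⌊[√ N - b ]/6⌋ ℤ.* + 6 ℤ.≤ k ℤ.* + 6
  ≤k*6 = subst (⌊[√ N - b ]/6⌋ ℤ.* + 6 ℤ.≤_) x≡k*6 ([n/ℕd]*d≤n x 6)

  k*6< : k ℤ.* + 6 ℤ.< ℤ.suc ⌊[√ N - b ]/6⌋ ℤ.* + 6
  k*6< = subst (ℤ._< ℤ.suc ⌊[√ N - b ]/6⌋ ℤ.* + 6) x≡k*6 (n<s[n/ℕd]*d x 6)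

[√_-_]/6∈ℤ? : ∀ N b → Dec [√ N - b ]/6∈ℤ
[√ N - b ]/6∈ℤ? = map′
  (⌊[√ N - b ]/6⌋ ,_)
  (λ (k , p) → subst (λ k → (+ 6 ℤ.* k ℤ.+ b) ≡√ N) (/6-exact k p) p)
  ((0ℤ ℤ.≤? y) ×-dec (y ℤ.* y ℤ.≟ + N))
  where
  y : ℤ
  y = + 6 ℤ.* ⌊[√ N - b ]/6⌋ ℤ.+ b

-- k(3k + b)/2; the division is exact for odd b.
pentagonal : ℤ → ℕ → ℤ
pentagonal b k = (+ k ℤ.* (+ 3 ℤ.* + k ℤ.+ b)) /ℕ 2

-- The ring is only required to be commutative; ℂ is the intended instance.

module Lambert {c ℓ} (R : CommutativeRing c ℓ) where

  open CommutativeRing R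
  open import Algebra.Properties.Semiring.Exp semiring using (_^_)
  open import Algebra.Properties.Semiring.Sum semiring public
    using (sum-syntax; sum⁺-syntax)

  -- Functions ℤ⁺ → R.
  Arith : Set c
  Arith = (n : ℕ) .{{_ : NonZero n}} → Carrier

  -- Σ_{k=1}^{x} F(k), empty for x ≤ 0.
  sum₁ : ℤ → Arith → Carrier
  sum₁ (+ n)    F = ∑[ j < n ] F (suc (toℕ j))
  sum₁ -[1+ _ ] F = 0#

  infixr 5 sum₁
  syntax sum₁ x (λ k → e) = ∑[ k ∈1⋯ x ] e

  sum± : (ℤ → Carrier) → Carrier
  sum± F = F 1ℤ + F -1ℤ

  infixr 5 sum±
  syntax sum± (λ b → e) = ∑[ b ≡±1] e

  [_]δ : ∀ {p} {P : Set p} → Dec P → Carrier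
  [ P? ]δ = if does P? then 1# else 0#

  -- k and ∣ k ∣ have the same parity.
  -1^_ : ℤ → Carrier
  -1^ k = (- 1#) ^ ∣ k ∣

  -- The truncated subtraction is exact: s < n / i gives (s + 1) i ≤ n.
  a : (n i : ℕ) .{{_ : NonZero i}} → Carrier
  a n i = ∑[ b ≡±1] ∑[ s < n / i ]
    (let N = 24 ℕ.* (n ℕ.∸ suc (toℕ s) ℕ.* i) ℕ.+ 1
     in -1^ ⌊[√ N - b ]/6⌋ * [ [√ N - b ]/6∈ℤ? ]δ)

  module _ (f : Arith) where

    g : Arith
    g m = ∑[ d ∈1⋯ + m ] [ d ∣? m ]δ * f d

    Σg : ℤ → Carrier
    Σg x = ∑[ m ∈1⋯ x ] g m

    aᶠ : ℕ → Carrier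
    aᶠ n = (∑[ i ∈1⋯ + n ] f i * a n i) + [ n ℕ.≟ 0 ]δ

-- The source prints the last sum of the recurrence as Σ_{k=1}^{n} a_f(k+1), which
-- loses the term a_f(1) = f(1): summing the recurrences for g_f(1), …, g_f(n+1)
-- gives Σ_{k=0}^{n} a_f(k+1).  With f = 1, n = 1 the printed form reads 3 = 2.
module _ where

  open Lambert ℤ.+-*-commutativeRing

  printed-range-fails :
    ¬ (∀ (f : Arith) (n : ℕ) → n ℕ.≥ 1 →
       Σg f (+ (n ℕ.+ 1))
         ≡ (∑[ b ≡±1] ∑[ k ∈1⋯ ⌊[√ 24 ℕ.* n ℕ.+ 1 - b ]/6⌋ ℤ.+ 1ℤ ]
              -1^ (+ (k ℕ.+ 1)) ℤ.* Σg f (+ (n ℕ.+ 1) ℤ.- pentagonal b k))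
           ℤ.+ (∑[ k ∈1⋯ + n ] aᶠ f (k ℕ.+ 1)))
  printed-range-fails h with () ← h (λ _ → 1ℤ) 1 (s≤s z≤n)

{-# OPTIONS --safe #-}
module Submission where

-- The recurrence is a double count; the pentagonal number theorem is not needed.
--
-- Let ε(M) be the sum of (-1)^k over the representations M = k(3k+b)/2 with
-- b = 1, k ≥ 0 or b = -1, k ≥ 1.  By definition a_{t,i} = Σ_{s≥1, si≤t} ε(t - si),
-- so collecting the multiples m = si (∑-multiples) shows that a_f is a convolution
-- (aᶠ≈ε*g):
--
--   a_f(t) = Σ_{m=1}^{t} ε(t - m) g_f(m)   for t ≥ 1.
--
-- Partial sums of a convolution are a convolution with partial sums
-- (∑-convolution), hence, as ε(0) = 1 (∑aᶠ),
--
--   Σ_{t=1}^{n+1} a_f(t) = Σ_{M=0}^{n} ε(M) Σ_{g,n+1-M}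
--                        = Σ_{g,n+1} + Σ_{M=1}^{n} ε(M) Σ_{g,n+1-M}.
--
-- It remains to identify the last sum with minus the double sum over b and k
-- (pentagonal-recurrence).  The condition √(24M+1) = 6k + b says that M is the
-- pentagonal number k(3k+b)/2, and it determines k for given b, so for each b the
-- sum over M can be reindexed by k (∑ε±≈∑pentagonal).  By monotonicity of the square
-- root, the k ≥ 1 with k(3k+b)/2 ≤ n are those up to ⌊(√(24n+1) - b)/6⌋.  The
-- recurrence has one further term, which is zero: there k(3k+b)/2 ≥ n+1, so the
-- average order is taken at an argument ≤ 0.

open import Level using (Level)
open import Algebra.Bundles using (CommutativeRing)
open import Data.Fin.Base using (toℕ)
open import Data.Fin.Properties using (toℕ<n; toℕ-inject₁; toℕ-fromℕ)
open import Data.Integer.Base as ℤ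
  using (ℤ; +_; -[1+_]; 0ℤ; 1ℤ; -1ℤ; ∣_∣; +≤+)
open import Data.Integer.DivMod using (_/ℕ_; [n/ℕd]*d≤n; n<s[n/ℕd]*d)
import Data.Integer.Properties as ℤ
open import Data.Integer.Solver using (module +-*-Solver)
open import Data.Nat.Base as ℕ using (ℕ; zero; suc; z≤n; s≤s)
open import Data.Nat.Divisibility using (_∣_; divides; _∣?_; ∣⇒≤)
open import Data.Nat.DivMod using (_/_; m*n/n≡m; m/n*n≤m; /-monoˡ-≤)
import Data.Nat.Properties as ℕ
import Data.Nat.Solver as ℕ
open import Data.Product.Base using (∃-syntax; _×_; _,_; proj₁; proj₂)
open import Function.Base using (_∘_)
open import Relation.Binary.PropositionalEquality as ≡
  using (_≡_; _≢_; cong; subst)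
open import Relation.Nullary.Negation using (¬_; contradiction)
open import Relation.Nullary.Decidable using (Dec; yes; no; dec-true; dec-false)
open import Defs

-- The two values of the sign b in k(3k+b)/2.
data ±1 : ℤ → Set where
  plus  : ±1 1ℤ
  minus : ±1 -1ℤ

-- Bounds on the index of a pentagonal number

⌊√⌋-mono-≤ : ∀ {m n} → m ℕ.≤ n → ⌊√ m ⌋ ℕ.≤ ⌊√ n ⌋
⌊√⌋-mono-≤ {m} {n} m≤n = ℕ.≮⇒≥ λ lt → ℕ.<⇒≱ (⌊√⌋-upper n)
  (ℕ.≤-trans (ℕ.*-mono-≤ lt lt) (ℕ.≤-trans (⌊√⌋-lower m) m≤n))

/ℕ-mono-≤ : ∀ d .{{_ : ℕ.NonZero d}} {x y} → x ℤ.≤ y → x /ℕ d ℤ.≤ y /ℕ d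
/ℕ-mono-≤ d@(suc _) {x} {y} x≤y = ℤ.≮⇒≥ λ lt → ℤ.<⇒≱
  (ℤ.<-≤-trans (n<s[n/ℕd]*d y d)
    (ℤ.*-monoʳ-≤-nonNeg (+ d) (ℤ.i<j⇒suc[i]≤j lt)))
  (ℤ.≤-trans ([n/ℕd]*d≤n x d) x≤y)

⌊[√-]/6⌋-mono-≤ : ∀ b {m n} → m ℕ.≤ n → ⌊[√ m - b ]/6⌋ ℤ.≤ ⌊[√ n - b ]/6⌋
⌊[√-]/6⌋-mono-≤ b m≤n =
  /ℕ-mono-≤ 6 (ℤ.+-monoˡ-≤ (ℤ.- b) (+≤+ (⌊√⌋-mono-≤ m≤n)))

-- For both signs the floor at n = 0 computes to 0, and the rest is monotonicity.
0≤⌊[√-]/6⌋ : ∀ {b} → ±1 b → ∀ n → 0ℤ ℤ.≤ ⌊[√ 24 ℕ.* n ℕ.+ 1 - b ]/6⌋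
0≤⌊[√-]/6⌋ plus  n = ⌊[√-]/6⌋-mono-≤ 1ℤ  (ℕ.m≤n+m 1 (24 ℕ.* n))
0≤⌊[√-]/6⌋ minus n = ⌊[√-]/6⌋-mono-≤ -1ℤ (ℕ.m≤n+m 1 (24 ℕ.* n))

24*-+1-mono-≤ : ∀ {m n} → m ℕ.≤ n → 24 ℕ.* m ℕ.+ 1 ℕ.≤ 24 ℕ.* n ℕ.+ 1
24*-+1-mono-≤ m≤n = ℕ.+-monoˡ-≤ 1 (ℕ.*-monoʳ-≤ 24 m≤n)

24*-+1-cancel-≤ : ∀ {m n} → 24 ℕ.* m ℕ.+ 1 ℕ.≤ 24 ℕ.* n ℕ.+ 1 → m ℕ.≤ n
24*-+1-cancel-≤ {m} {n} le =
  ℕ.*-cancelˡ-≤ 24 (ℕ.+-cancelʳ-≤ 1 (24 ℕ.* m) (24 ℕ.* n) le)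

-- If 6k + b = √(24p+1), then p ≤ n is equivalent to k ≤ ⌊(√(24n+1) - b)/6⌋; this lemma
-- and the next are the two implications.  For b = ±1 the hypothesis says that p is the
-- pentagonal number k(3k+b)/2.
≤⇒index≤ : ∀ {b k p n} → (+ 6 ℤ.* k ℤ.+ b) ≡√ (24 ℕ.* p ℕ.+ 1) →
           p ℕ.≤ n → k ℤ.≤ ⌊[√ 24 ℕ.* n ℕ.+ 1 - b ]/6⌋
≤⇒index≤ {b} {k} root p≤n =
  subst (ℤ._≤ _) (≡.sym (/6-exact k root)) (⌊[√-]/6⌋-mono-≤ b (24*-+1-mono-≤ p≤n))

index≤⇒≤ : ∀ {b k p n} → (+ 6 ℤ.* k ℤ.+ b) ≡√ (24 ℕ.* p ℕ.+ 1) →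
           k ℤ.≤ ⌊[√ 24 ℕ.* n ℕ.+ 1 - b ]/6⌋ → p ℕ.≤ n
index≤⇒≤ {b} {k} {p} {n} root k≤ = 24*-+1-cancel-≤ (begin
    24 ℕ.* p ℕ.+ 1   ≡⟨ ℤ.+-injective (≡.trans (≡.sym (proj₂ root))
                          (≡.trans (≡.cong₂ ℤ._*_ x≡r x≡r) (≡.sym (ℤ.pos-* r r)))) ⟩
    r ℕ.* r          ≤⟨ ℕ.*-mono-≤ r≤s r≤s ⟩
    s ℕ.* s          ≤⟨ ⌊√⌋-lower _ ⟩
    24 ℕ.* n ℕ.+ 1   ∎)
  where
  open ℕ.≤-Reasoning
  r s : ℕ
  r = ⌊√ 24 ℕ.* p ℕ.+ 1 ⌋
  s = ⌊√ 24 ℕ.* n ℕ.+ 1 ⌋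

  x≡r : + 6 ℤ.* k ℤ.+ b ≡ + r
  x≡r = ≡√⇒≡⌊√⌋ root

  r≤s : r ℕ.≤ s
  r≤s = ℤ.drop‿+≤+ (Z.begin
      + r                       Z.≡⟨ x≡r ⟨
      + 6 ℤ.* k ℤ.+ b           Z.≡⟨ cong (ℤ._+ b) (ℤ.*-comm (+ 6) k) ⟩
      k ℤ.* + 6 ℤ.+ b           Z.≤⟨ ℤ.+-monoˡ-≤ b (ℤ.≤-trans
                                      (ℤ.*-monoʳ-≤-nonNeg (+ 6) k≤)
                                      ([n/ℕd]*d≤n (+ s ℤ.- b) 6)) ⟩
      (+ s ℤ.- b) ℤ.+ b         Z.≡⟨ solve 2 (λ s b → (s :- b) :+ b := s) ≡.refl (+ s) b ⟩
      + s                       Z.∎)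
    where
    module Z = ℤ.≤-Reasoning
    open +-*-Solver

-- Pentagonal numbers and the square root condition

-- n(n+1)/2.
triangular : ℕ → ℕ
triangular zero    = 0
triangular (suc n) = suc n ℕ.+ triangular n

triangular*2 : ∀ n → triangular n ℕ.* 2 ≡ n ℕ.* suc n
triangular*2 zero    = ≡.refl
triangular*2 (suc n) = begin
  (suc n ℕ.+ triangular n) ℕ.* 2      ≡⟨ ℕ.*-distribʳ-+ 2 (suc n) (triangular n) ⟩
  suc n ℕ.* 2 ℕ.+ triangular n ℕ.* 2  ≡⟨ cong (suc n ℕ.* 2 ℕ.+_) (triangular*2 n) ⟩
  suc n ℕ.* 2 ℕ.+ n ℕ.* suc n         ≡⟨ solve 1 (λ n → (con 1 :+ n) :* con 2 :+ n :* (con 1 :+ n)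
                                           := (con 1 :+ n) :* (con 2 :+ n)) ≡.refl n ⟩
  suc n ℕ.* suc (suc n)               ∎
  where
  open ≡.≡-Reasoning
  open ℕ.+-*-Solver

half : ∀ {z p} → z ≡ + p ℤ.* + 2 → z /ℕ 2 ≡ + p
half {p = p} ≡.refl =
  ≡.trans (cong (_/ℕ 2) (≡.sym (ℤ.pos-* p 2))) (cong +_ (m*n/n≡m p 2))

triangular*2-ℤ : ∀ n → + triangular n ℤ.* + 2 ≡ + n ℤ.* + suc n
triangular*2-ℤ n = ≡.trans (≡.sym (ℤ.pos-* (triangular n) 2))
  (≡.trans (cong +_ (triangular*2 n)) (ℤ.pos-* n (suc n)))

-- For k = j + 1, half of k(3k+b) is k² + k(k+b)/2, which is written as a successor
-- because it is positive.
2∣k[3k±1] : ∀ {b} → ±1 b → ∀ j →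
            ∃[ p ] + suc j ℤ.* (+ 3 ℤ.* + suc j ℤ.+ b) ≡ + suc p ℤ.* + 2
2∣k[3k±1] plus j = j ℕ.+ j ℕ.* k ℕ.+ triangular k , (begin
    + k ℤ.* (+ 3 ℤ.* + k ℤ.+ 1ℤ)
      ≡⟨ solve 1 (λ k → k :* (con (+ 3) :* k :+ con 1ℤ)
           := k :* k :* con (+ 2) :+ k :* (con 1ℤ :+ k)) ≡.refl (+ k) ⟩
    + k ℤ.* + k ℤ.* + 2 ℤ.+ + k ℤ.* + suc k
      ≡⟨ ≡.cong₂ (λ x y → x ℤ.* + 2 ℤ.+ y) (ℤ.pos-* k k) (triangular*2-ℤ k) ⟨
    + (k ℕ.* k) ℤ.* + 2 ℤ.+ + triangular k ℤ.* + 2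
      ≡⟨ ℤ.*-distribʳ-+ (+ 2) (+ (k ℕ.* k)) (+ triangular k) ⟨
    + (k ℕ.* k ℕ.+ triangular k) ℤ.* + 2 ∎)
  where
  open ≡.≡-Reasoning
  open +-*-Solver
  k = suc j
2∣k[3k±1] minus j = j ℕ.+ j ℕ.* k ℕ.+ triangular j , (begin
    + k ℤ.* (+ 3 ℤ.* + k ℤ.+ -1ℤ)
      ≡⟨ solve 1 (λ j → (con 1ℤ :+ j) :* (con (+ 3) :* (con 1ℤ :+ j) :+ con -1ℤ)
           := (con 1ℤ :+ j) :* (con 1ℤ :+ j) :* con (+ 2) :+ j :* (con 1ℤ :+ j))
           ≡.refl (+ j) ⟩
    + k ℤ.* + k ℤ.* + 2 ℤ.+ + j ℤ.* + suc j
      ≡⟨ ≡.cong₂ (λ x y → x ℤ.* + 2 ℤ.+ y) (ℤ.pos-* k k) (triangular*2-ℤ j) ⟨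
    + (k ℕ.* k) ℤ.* + 2 ℤ.+ + triangular j ℤ.* + 2
      ≡⟨ ℤ.*-distribʳ-+ (+ 2) (+ (k ℕ.* k)) (+ triangular j) ⟨
    + (k ℕ.* k ℕ.+ triangular j) ℤ.* + 2 ∎)
  where
  open ≡.≡-Reasoning
  open +-*-Solver
  k = suc j

-- For k ≥ 1 the number k(3k+b)/2 is a positive natural number p, and
-- 6k + b = √(24p+1).
pentagonal-root : ∀ {b} → ±1 b → ∀ j → ∃[ p ] (pentagonal b (suc j) ≡ + suc p ×
                  (+ 6 ℤ.* + suc j ℤ.+ b) ≡√ (24 ℕ.* suc p ℕ.+ 1))
pentagonal-root {b} s j with 2∣k[3k±1] s j
... | p , eq = p , half eq , 0≤ s , (begin
    (+ 6 ℤ.* k ℤ.+ b) ℤ.* (+ 6 ℤ.* k ℤ.+ b)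
      ≡⟨ solve 2 (λ k b → (con (+ 6) :* k :+ b) :* (con (+ 6) :* k :+ b)
           := con (+ 12) :* (k :* (con (+ 3) :* k :+ b)) :+ b :* b) ≡.refl k b ⟩
    + 12 ℤ.* (k ℤ.* (+ 3 ℤ.* k ℤ.+ b)) ℤ.+ b ℤ.* b
      ≡⟨ ≡.cong₂ (λ x y → + 12 ℤ.* x ℤ.+ y) eq (b² s) ⟩
    + 12 ℤ.* (+ suc p ℤ.* + 2) ℤ.+ 1ℤ
      ≡⟨ solve 1 (λ p → con (+ 12) :* (p :* con (+ 2)) :+ con 1ℤ
           := con (+ 24) :* p :+ con 1ℤ) ≡.refl (+ suc p) ⟩
    + 24 ℤ.* + suc p ℤ.+ 1ℤ
      ≡⟨ cong (ℤ._+ 1ℤ) (ℤ.pos-* 24 (suc p)) ⟨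
    + (24 ℕ.* suc p ℕ.+ 1) ∎)
  where
  open ≡.≡-Reasoning
  open +-*-Solver
  k = + suc j

  0≤ : ∀ {b} → ±1 b → 0ℤ ℤ.≤ + 6 ℤ.* + suc j ℤ.+ b
  0≤ plus  = +≤+ z≤n
  0≤ minus = +≤+ z≤n

  b² : ∀ {b} → ±1 b → b ℤ.* b ≡ 1ℤ
  b² plus  = ≡.refl
  b² minus = ≡.refl

-- A root 6k + b of 24M + 1 with M ≥ 1 has k ≥ 1: for k = 0 its square is 1, and for
-- k < 0 it is negative.
root-positive : ∀ {b} → ±1 b → ∀ k m →
                (+ 6 ℤ.* k ℤ.+ b) ≡√ (24 ℕ.* suc m ℕ.+ 1) → ∃[ j ] k ≡ + suc j
root-positive s     (+ suc j) m _ = j , ≡.refl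
root-positive plus  (+ zero)  m (_ , eq) = contradiction
  (≡.trans (ℕ.suc-injective (ℤ.+-injective eq)) (ℕ.+-comm (m ℕ.+ 23 ℕ.* suc m) 1)) λ ()
root-positive minus (+ zero)  m (() , _)
root-positive plus  -[1+ zero ]  m (() , _)
root-positive plus  -[1+ suc _ ] m (() , _)
root-positive minus -[1+ _ ]  m (() , _)

module _ {c ℓ} (R : CommutativeRing c ℓ) where

  open CommutativeRing R
  open Lambert R
  open import Algebra.Properties.CommutativeSemigroup *-commutativeSemigroup
    using (x∙yz≈z∙yx; xy∙z≈y∙xz)
  open import Algebra.Properties.Ring ring using (-1*x≈-x)
  open import Algebra.Properties.Semiring.Sum semiring
    using (sum-cong-≋; sum-replicate-zero; sum-init-last; ∑-distrib-+; ∑-comm;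
           *-distribˡ-sum; *-distribʳ-sum)
  open import Relation.Binary.Reasoning.Setoid setoid

  -- Sums over initial segments of the natural numbers

  []δ-true : ∀ {P : Set} (P? : Dec P) → P → [ P? ]δ ≈ 1#
  []δ-true P? p rewrite dec-true P? p = refl

  []δ-false : ∀ {P : Set} (P? : Dec P) → ¬ P → [ P? ]δ ≈ 0#
  []δ-false P? ¬p rewrite dec-false P? ¬p = refl

  ∑-cong : ∀ n {F G : ℕ → Carrier} → (∀ i → i ℕ.< n → F i ≈ G i) →
           ∑[ i < n ] F (toℕ i) ≈ ∑[ i < n ] G (toℕ i)
  ∑-cong n F≈G = sum-cong-≋ {n} (λ i → F≈G (toℕ i) (toℕ<n i))

  ∑-zero : ∀ n {F : ℕ → Carrier} → (∀ i → i ℕ.< n → F i ≈ 0#) →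
           ∑[ i < n ] F (toℕ i) ≈ 0#
  ∑-zero n F≈0 = trans (∑-cong n F≈0) (sum-replicate-zero n)

  -- A sum whose terms of index other than s are zero.
  ∑-single : ∀ n s {F : ℕ → Carrier} → s ℕ.< n →
             (∀ i → i ℕ.< n → i ≢ s → F i ≈ 0#) → ∑[ i < n ] F (toℕ i) ≈ F s
  ∑-single (suc n) zero    _         F≈0 = trans
    (+-congˡ (∑-zero n λ i i<n → F≈0 (suc i) (s≤s i<n) λ ())) (+-identityʳ _)
  ∑-single (suc n) (suc s) (s≤s s<n) F≈0 = trans
    (+-cong (F≈0 0 (s≤s z≤n) λ ())
      (∑-single n s s<n λ i i<n i≢s → F≈0 (suc i) (s≤s i<n) (i≢s ∘ ℕ.suc-injective)))
    (+-identityˡ _)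

  ∑-last : ∀ n (F : ℕ → Carrier) →
           ∑[ i < suc n ] F (toℕ i) ≈ ∑[ i < n ] F (toℕ i) + F n
  ∑-last n F = trans (sum-init-last {n} (F ∘ toℕ)) (+-cong
    (sum-cong-≋ {n} (λ i → reflexive (cong F (toℕ-inject₁ i))))
    (reflexive (cong F (toℕ-fromℕ n))))

  ∑-truncate : ∀ {m n} (F : ℕ → Carrier) → m ℕ.≤ n → (∀ i → m ℕ.≤ i → F i ≈ 0#) →
               ∑[ i < n ] F (toℕ i) ≈ ∑[ i < m ] F (toℕ i)
  ∑-truncate {n = n} F z≤n F≈0 = ∑-zero n (λ i _ → F≈0 i z≤n)
  ∑-truncate F (s≤s m≤n) F≈0 =
    +-congˡ (∑-truncate (F ∘ suc) m≤n λ i m≤i → F≈0 (suc i) (s≤s m≤i))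

  -- Reindexing along φ, a bijection from the numbers below q to the numbers below N
  -- that satisfy P.  Both sides equal the sum of [φ(s) = m] h(m) over all m < N and
  -- s < q.
  ∑-reindex : ∀ N q {P : ℕ → Set} (P? : ∀ m → Dec (P m))
              (φ : ℕ → ℕ) (h : ℕ → Carrier) →
              (∀ s → s ℕ.< q → φ s ℕ.< N × P (φ s)) →
              (∀ s t → s ℕ.< q → t ℕ.< q → φ s ≡ φ t → s ≡ t) →
              (∀ m → m ℕ.< N → P m → ∃[ s ] (s ℕ.< q × φ s ≡ m)) →
              ∑[ m < N ] ([ P? (toℕ m) ]δ * h (toℕ m)) ≈ ∑[ s < q ] h (φ (toℕ s))
  ∑-reindex N q {P} P? φ h into injective onto = begin
    ∑[ m < N ] ([ P? (toℕ m) ]δ * h (toℕ m))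
      ≈⟨ ∑-cong N (λ m m<N → *-congʳ {h m} (fibre m m<N)) ⟩
    ∑[ m < N ] ((∑[ s < q ] δ (toℕ s) (toℕ m)) * h (toℕ m))
      ≈⟨ sum-cong-≋ {N} (λ m → *-distribʳ-sum {q} (h (toℕ m)) (λ s → δ (toℕ s) (toℕ m))) ⟩
    ∑[ m < N ] ∑[ s < q ] (δ (toℕ s) (toℕ m) * h (toℕ m))
      ≈⟨ ∑-comm {N} {q} (λ m s → δ (toℕ s) (toℕ m) * h (toℕ m)) ⟩
    ∑[ s < q ] ∑[ m < N ] (δ (toℕ s) (toℕ m) * h (toℕ m))
      ≈⟨ ∑-cong q (λ s s<q → begin
           ∑[ m < N ] (δ s (toℕ m) * h (toℕ m))
             ≈⟨ ∑-single N (φ s) (proj₁ (into s s<q)) (λ m _ m≢φs →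
                  trans (*-congʳ ([]δ-false (φ s ℕ.≟ m) (m≢φs ∘ ≡.sym))) (zeroˡ (h m))) ⟩
           δ s (φ s) * h (φ s)
             ≈⟨ *-congʳ ([]δ-true (φ s ℕ.≟ φ s) ≡.refl) ⟩
           1# * h (φ s)
             ≈⟨ *-identityˡ (h (φ s)) ⟩
           h (φ s) ∎) ⟩
    ∑[ s < q ] h (φ (toℕ s)) ∎
    where
    δ : ℕ → ℕ → Carrier
    δ s m = [ φ s ℕ.≟ m ]δ

    -- The fibre of φ over m has one element if P holds at m, and none otherwise.
    fibre : ∀ m → m ℕ.< N → [ P? m ]δ ≈ ∑[ s < q ] δ (toℕ s) m
    fibre m m<N with P? m
    ... | no ¬p = sym (∑-zero q λ s s<q → []δ-false (φ s ℕ.≟ m) λ φs≡m →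
                    ¬p (subst P φs≡m (proj₂ (into s s<q))))
    ... | yes p with onto m m<N p
    ...   | s , s<q , φs≡m = sym (trans
              (∑-single q s s<q λ t t<q t≢s → []δ-false (φ t ℕ.≟ m) λ φt≡m →
                t≢s (injective t s t<q s<q (≡.trans φt≡m (≡.sym φs≡m))))
              ([]δ-true (φ s ℕ.≟ m) φs≡m))

  -- The multiples of i + 1 among 1, ..., t are (s + 1)(i + 1) for s < ⌊t/(i+1)⌋.
  ∑-multiples : ∀ t i (h : ℕ → Carrier) →
                ∑[ m < t ] ([ suc i ∣? suc (toℕ m) ]δ * h (suc (toℕ m)))
                  ≈ ∑[ s < t / suc i ] h (suc (toℕ s) ℕ.* suc i)
  ∑-multiples t i h = ∑-reindex t (t / suc i) (λ m → suc i ∣? suc m)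
    (λ s → i ℕ.+ s ℕ.* suc i) (h ∘ suc)
    (λ s s<q → ℕ.≤-trans (ℕ.*-monoˡ-≤ (suc i) s<q) (m/n*n≤m t (suc i)) ,
               divides (suc s) ≡.refl)
    (λ s s′ _ _ eq → ℕ.*-cancelʳ-≡ s s′ (suc i) (ℕ.+-cancelˡ-≡ i _ _ eq))
    onto
    where
    onto : ∀ m → m ℕ.< t → suc i ∣ suc m →
           ∃[ s ] (s ℕ.< t / suc i × i ℕ.+ s ℕ.* suc i ≡ m)
    onto m m<t (divides (suc s) eq) = s ,
      subst (ℕ._≤ t / suc i)
        (≡.trans (cong (_/ suc i) eq) (m*n/n≡m (suc s) (suc i)))
        (/-monoˡ-≤ (suc i) m<t) ,
      ≡.sym (ℕ.suc-injective eq)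

  -- Partial sums of the convolution of u and v.  The induction splits off u(0), which
  -- contributes the last term of every inner sum on the left, and shifts u by one.
  ∑-convolution : ∀ N (u v : ℕ → Carrier) →
    ∑[ t < N ] ∑[ m < suc (toℕ t) ] (u (toℕ t ℕ.∸ toℕ m) * v (toℕ m))
      ≈ ∑[ M < N ] (u (toℕ M) * ∑[ m < N ℕ.∸ toℕ M ] v (toℕ m))
  ∑-convolution zero    u v = refl
  ∑-convolution (suc N) u v = begin
    ∑[ t < suc N ] conv u (suc (toℕ t)) (toℕ t)
      ≈⟨ ∑-cong (suc N) (λ t _ → trans (∑-last t (λ m → u (t ℕ.∸ m) * v m))
           (+-congˡ (*-congʳ (reflexive (cong u (ℕ.n∸n≡0 t)))))) ⟩
    ∑[ t < suc N ] (conv u (toℕ t) (toℕ t) + u 0 * v (toℕ t))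
      ≈⟨ ∑-distrib-+ {suc N} (λ t → conv u (toℕ t) (toℕ t)) (λ t → u 0 * v (toℕ t)) ⟩
    (0# + ∑[ t < N ] conv u (suc (toℕ t)) (suc (toℕ t)))
      + ∑[ t < suc N ] (u 0 * v (toℕ t))
      ≈⟨ +-cong (+-identityˡ _) (sym (*-distribˡ-sum {suc N} (u 0) (v ∘ toℕ))) ⟩
    ∑[ t < N ] conv u (suc (toℕ t)) (suc (toℕ t)) + u 0 * ∑[ t < suc N ] v (toℕ t)
      ≈⟨ +-congʳ (∑-cong N {λ t → conv u (suc t) (suc t)} (λ t _ → ∑-cong (suc t) (λ m m≤t →
           *-congʳ {v m} (reflexive (cong u (ℕ.+-∸-assoc 1 (ℕ.s≤s⁻¹ m≤t))))))) ⟩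
    ∑[ t < N ] conv (u ∘ suc) (suc (toℕ t)) (toℕ t) + u 0 * ∑[ t < suc N ] v (toℕ t)
      ≈⟨ +-congʳ (∑-convolution N (u ∘ suc) v) ⟩
    ∑[ M < N ] (u (suc (toℕ M)) * ∑[ m < N ℕ.∸ toℕ M ] v (toℕ m))
      + u 0 * ∑[ t < suc N ] v (toℕ t)
      ≈⟨ +-comm _ _ ⟩
    ∑[ M < suc N ] (u (toℕ M) * ∑[ m < suc N ℕ.∸ toℕ M ] v (toℕ m)) ∎
    where
    -- The first k terms of the convolution of u and v at t.
    conv : (ℕ → Carrier) → ℕ → ℕ → Carrier
    conv u k t = ∑[ m < k ] (u (t ℕ.∸ toℕ m) * v (toℕ m))

  -- The sequence a_f as a convolution

  -- The contribution of the sign b to ε(M): (-1)^k if √(24M+1) = 6k + b for an integer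
  -- k, and 0 if there is no such k.
  ε± : ℤ → ℕ → Carrier
  ε± b M = -1^ ⌊[√ 24 ℕ.* M ℕ.+ 1 - b ]/6⌋ * [ [√ 24 ℕ.* M ℕ.+ 1 - b ]/6∈ℤ? ]δ

  -- The coefficient of q^M in the series of (-1)^k q^(k(3k+1)/2) over all integers k.
  ε : ℕ → Carrier
  ε M = ∑[ b ≡±1] ε± b M

  -- M = 0 is represented for b = 1 only, by k = 0.
  ε[0]≈1 : ε 0 ≈ 1#
  ε[0]≈1 = trans (+-cong (*-identityʳ 1#) (zeroʳ 1#)) (+-identityʳ 1#)

  a≈∑ε : ∀ t i → a t (suc i) ≈
         ∑[ m < t ] ([ suc i ∣? suc (toℕ m) ]δ * ε (t ℕ.∸ suc (toℕ m)))
  a≈∑ε t i = trans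
    (sym (∑-distrib-+ {t / suc i}
      (λ s → ε± 1ℤ  (t ℕ.∸ suc (toℕ s) ℕ.* suc i))
      (λ s → ε± -1ℤ (t ℕ.∸ suc (toℕ s) ℕ.* suc i))))
    (sym (∑-multiples t i (λ m → ε (t ℕ.∸ m))))

  -- After the exchange of sums, i runs up to t, but only i ≤ m can divide m, so the sum
  -- over i reduces to the one that defines g.
  aᶠ≈ε*g : ∀ (f : Arith) t → aᶠ f (suc t) ≈
           ∑[ m < suc t ] (ε (t ℕ.∸ toℕ m) * g f (suc (toℕ m)))
  aᶠ≈ε*g f t = begin
    ∑[ i < suc t ] (f (suc (toℕ i)) * a (suc t) (suc (toℕ i))) + 0#
      ≈⟨ +-identityʳ _ ⟩
    ∑[ i < suc t ] (f (suc (toℕ i)) * a (suc t) (suc (toℕ i)))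
      ≈⟨ ∑-cong (suc t) (λ i _ → trans (*-congˡ (a≈∑ε (suc t) i))
           (*-distribˡ-sum {suc t} (f (suc i))
             (λ m → [ suc i ∣? suc (toℕ m) ]δ * ε (t ℕ.∸ toℕ m)))) ⟩
    ∑[ i < suc t ] ∑[ m < suc t ] term (toℕ i) (toℕ m)
      ≈⟨ ∑-comm {suc t} {suc t} (λ i m → term (toℕ i) (toℕ m)) ⟩
    ∑[ m < suc t ] ∑[ i < suc t ] term (toℕ i) (toℕ m)
      ≈⟨ ∑-cong (suc t) (λ m m≤t → begin
           ∑[ i < suc t ] term (toℕ i) m
             ≈⟨ ∑-truncate (λ i → term i m) m≤t (λ i m<i → trans
                  (*-congˡ (trans (*-congʳ ([]δ-false (suc i ∣? suc m) (λ i∣m →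
                    ℕ.<⇒≱ m<i (ℕ.s≤s⁻¹ (∣⇒≤ i∣m))))) (zeroˡ _)))
                  (zeroʳ _)) ⟩
           ∑[ i < suc m ] term (toℕ i) m
             ≈⟨ ∑-cong (suc m) (λ i _ →
                  x∙yz≈z∙yx (f (suc i)) [ suc i ∣? suc m ]δ (ε (t ℕ.∸ m))) ⟩
           ∑[ i < suc m ] (ε (t ℕ.∸ m) * ([ suc (toℕ i) ∣? suc m ]δ * f (suc (toℕ i))))
             ≈⟨ *-distribˡ-sum {suc m} (ε (t ℕ.∸ m))
                  (λ i → [ suc (toℕ i) ∣? suc m ]δ * f (suc (toℕ i))) ⟨
           ε (t ℕ.∸ m) * g f (suc m) ∎) ⟩
    ∑[ m < suc t ] (ε (t ℕ.∸ toℕ m) * g f (suc (toℕ m))) ∎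
    where
    term : ℕ → ℕ → Carrier
    term i m = f (suc i) * ([ suc i ∣? suc m ]δ * ε (t ℕ.∸ m))

  -- Reindexing by pentagonal numbers

  -- The terms on the left, for 1 ≤ M ≤ n, are supported on M = k(3k+b)/2, where
  -- k = j + 1 runs over 1, ..., K.
  ∑ε±≈∑pentagonal : ∀ {b} → ±1 b → ∀ n K → ⌊[√ 24 ℕ.* n ℕ.+ 1 - b ]/6⌋ ≡ + K →
    (G : ℤ → Carrier) →
    ∑[ M < n ] (ε± b (suc (toℕ M)) * G (+ suc (toℕ M)))
      ≈ ∑[ j < K ] (-1^ (+ suc (toℕ j)) * G (pentagonal b (suc (toℕ j))))
  ∑ε±≈∑pentagonal {b} s n K K≡ G = begin
    ∑[ M < n ] (ε± b (suc (toℕ M)) * G (+ suc (toℕ M)))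
      ≈⟨ ∑-cong n (λ M _ → xy∙z≈y∙xz
           (-1^ ⌊[√ 24 ℕ.* suc M ℕ.+ 1 - b ]/6⌋) [ root? (suc M) ]δ (G (+ suc M))) ⟩
    ∑[ M < n ] ([ root? (suc (toℕ M)) ]δ * h (suc (toℕ M)))
      ≈⟨ ∑-reindex n K (root? ∘ suc) φ (h ∘ suc) into injective onto ⟩
    ∑[ j < K ] h (suc (φ (toℕ j)))
      ≈⟨ ∑-cong K (λ j _ → *-cong
           (reflexive (cong -1^_ (≡.sym (index j))))
           (reflexive (cong G (≡.sym (value j))))) ⟩
    ∑[ j < K ] (-1^ (+ suc (toℕ j)) * G (pentagonal b (suc (toℕ j)))) ∎
    where
    root? : ∀ M → Dec [√ 24 ℕ.* M ℕ.+ 1 - b ]/6∈ℤ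
    root? M = [√ 24 ℕ.* M ℕ.+ 1 - b ]/6∈ℤ?

    h : ℕ → Carrier
    h M = -1^ ⌊[√ 24 ℕ.* M ℕ.+ 1 - b ]/6⌋ * G (+ M)

    -- k(3k+b)/2 = φ(j) + 1 for k = j + 1.
    φ : ℕ → ℕ
    φ j = proj₁ (pentagonal-root s j)

    spec : ∀ j → pentagonal b (suc j) ≡ + suc (φ j) ×
                 (+ 6 ℤ.* + suc j ℤ.+ b) ≡√ (24 ℕ.* suc (φ j) ℕ.+ 1)
    spec j = proj₂ (pentagonal-root s j)

    value : ∀ j → pentagonal b (suc j) ≡ + suc (φ j)
    value j = proj₁ (spec j)

    index : ∀ j → + suc j ≡ ⌊[√ 24 ℕ.* suc (φ j) ℕ.+ 1 - b ]/6⌋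
    index j = /6-exact {b = b} (+ suc j) (proj₂ (spec j))

    into : ∀ j → j ℕ.< K → φ j ℕ.< n × [√ 24 ℕ.* suc (φ j) ℕ.+ 1 - b ]/6∈ℤ
    into j j<K =
      index≤⇒≤ {b} {+ suc j} {suc (φ j)} {n} (proj₂ (spec j))
        (subst (+ suc j ℤ.≤_) (≡.sym K≡) (+≤+ j<K)) ,
      + suc j , proj₂ (spec j)

    injective : ∀ i j → i ℕ.< K → j ℕ.< K → φ i ≡ φ j → i ≡ j
    injective i j _ _ eq = ℕ.suc-injective (ℤ.+-injective (≡.trans (index i)
      (≡.trans (cong (λ M → ⌊[√ 24 ℕ.* suc M ℕ.+ 1 - b ]/6⌋) eq) (≡.sym (index j)))))

    onto : ∀ M → M ℕ.< n → [√ 24 ℕ.* suc M ℕ.+ 1 - b ]/6∈ℤ →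
           ∃[ j ] (j ℕ.< K × φ j ≡ M)
    onto M M<n (k , root) with root-positive s k M root
    ... | j , ≡.refl = j ,
      ℤ.drop‿+≤+ (subst (+ suc j ℤ.≤_) K≡ (≤⇒index≤ {b} {+ suc j} {suc M} {n} root M<n)) ,
      ℕ.suc-injective (radicand-injective {+ 6 ℤ.* + suc j ℤ.+ b} {suc (φ j)} {suc M}
        (proj₂ (spec j)) root)
      where
      radicand-injective : ∀ {x p q} → x ≡√ (24 ℕ.* p ℕ.+ 1) → x ≡√ (24 ℕ.* q ℕ.+ 1) → p ≡ q
      radicand-injective {p = p} {q} (_ , eq) (_ , eq′) = ℕ.*-cancelˡ-≡ p q 24
        (ℕ.+-cancelʳ-≡ 1 (24 ℕ.* p) (24 ℕ.* q)
          (ℤ.+-injective (≡.trans (≡.sym eq) eq′)))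

  -- The recurrence, separately for each sign

  -1^[1+n]≈-[-1^n] : ∀ n → -1^ (+ (n ℕ.+ 1)) ≈ - (-1^ (+ n))
  -1^[1+n]≈-[-1^n] n rewrite ℕ.+-comm n 1 = -1*x≈-x (-1^ (+ n))

  Σg[x≤0]≈0 : ∀ f {x} → x ℤ.≤ 0ℤ → Σg f x ≈ 0#
  Σg[x≤0]≈0 f {+ zero}   _ = refl
  Σg[x≤0]≈0 f {+ suc _}  (+≤+ ())
  Σg[x≤0]≈0 f { -[1+ _ ]} _ = refl

  -- The part of the recurrence that belongs to the sign b.
  pentagonal-recurrence : ∀ {b} → ±1 b → ∀ f n →
    ∑[ k ∈1⋯ ⌊[√ 24 ℕ.* n ℕ.+ 1 - b ]/6⌋ ℤ.+ 1ℤ ]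
        -1^ (+ (k ℕ.+ 1)) * Σg f (+ suc n ℤ.- pentagonal b k)
      ≈ - (∑[ M < n ] (ε± b (suc (toℕ M)) * Σg f (+ suc n ℤ.- + suc (toℕ M))))
  pentagonal-recurrence {b} s f n = go ⌊[√ 24 ℕ.* n ℕ.+ 1 - b ]/6⌋ ≡.refl (0≤⌊[√-]/6⌋ s n)
    where
    G : ℤ → Carrier
    G x = Σg f (+ suc n ℤ.- x)

    -- The floor is generalised to a variable z, so that the upper limit can be matched
    -- on.
    go : ∀ z → ⌊[√ 24 ℕ.* n ℕ.+ 1 - b ]/6⌋ ≡ z → 0ℤ ℤ.≤ z →
         ∑[ k ∈1⋯ z ℤ.+ 1ℤ ] -1^ (+ (k ℕ.+ 1)) * G (pentagonal b k)
           ≈ - (∑[ M < n ] (ε± b (suc (toℕ M)) * G (+ suc (toℕ M))))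
    go (+ K) K≡ _ = begin
      ∑[ k ∈1⋯ + (K ℕ.+ 1) ] -1^ (+ (k ℕ.+ 1)) * G (pentagonal b k)
        ≈⟨ reflexive (cong (λ x → ∑[ j < x ] term (toℕ j)) (ℕ.+-comm K 1)) ⟩
      ∑[ j < suc K ] term (toℕ j)
        ≈⟨ ∑-last K term ⟩
      ∑[ j < K ] term (toℕ j) + term K
        ≈⟨ +-congˡ (trans (*-congˡ last-vanishes) (zeroʳ _)) ⟩
      ∑[ j < K ] term (toℕ j) + 0#
        ≈⟨ +-identityʳ _ ⟩
      ∑[ j < K ] term (toℕ j)
        ≈⟨ ∑-cong K {term} {λ j → - 1# * term⁻ j} (λ j _ → trans
             (*-congʳ (trans (-1^[1+n]≈-[-1^n] (suc j)) (sym (-1*x≈-x _))))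
             (*-assoc (- 1#) (-1^ (+ suc j)) _)) ⟩
      ∑[ j < K ] (- 1# * term⁻ (toℕ j))
        ≈⟨ *-distribˡ-sum {K} (- 1#) (term⁻ ∘ toℕ) ⟨
      - 1# * ∑[ j < K ] term⁻ (toℕ j)
        ≈⟨ -1*x≈-x _ ⟩
      - (∑[ j < K ] term⁻ (toℕ j))
        ≈⟨ -‿cong (∑ε±≈∑pentagonal s n K K≡ G) ⟨
      - (∑[ M < n ] (ε± b (suc (toℕ M)) * G (+ suc (toℕ M)))) ∎
      where
      -- The terms of index k = j + 1, with sign (-1)^(k+1) and with sign (-1)^k.
      term term⁻ : ℕ → Carrier
      term  j = -1^ (+ (suc j ℕ.+ 1)) * G (pentagonal b (suc j))
      term⁻ j = -1^ (+ suc j) * G (pentagonal b (suc j))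

      -- The index K + 1 exceeds the bound, so its pentagonal number exceeds n.
      last-vanishes : G (pentagonal b (suc K)) ≈ 0#
      last-vanishes = vanish (pentagonal-root s K)
        where
        vanish : ∃[ p ] (pentagonal b (suc K) ≡ + suc p ×
                   (+ 6 ℤ.* + suc K ℤ.+ b) ≡√ (24 ℕ.* suc p ℕ.+ 1)) →
                 G (pentagonal b (suc K)) ≈ 0#
        vanish (p , value , root) = Σg[x≤0]≈0 f
          (subst (λ x → + suc n ℤ.- x ℤ.≤ 0ℤ) (≡.sym value) (ℤ.i≤j⇒i-j≤0 (+≤+ n<1+p)))
          where
          n<1+p : n ℕ.< suc p
          n<1+p = ℕ.≰⇒> λ 1+p≤n → ℕ.<-irrefl ≡.refl (ℤ.drop‿+≤+
            (subst (+ suc K ℤ.≤_) K≡ (≤⇒index≤ {b} {+ suc K} {suc p} {n} root 1+p≤n)))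

  -- The term M = 0 of the convolution gives the average order at n + 1; the others are
  -- separated by the sign b.
  ∑aᶠ : ∀ f n →
    ∑[ k ≤ n ] aᶠ f (toℕ k ℕ.+ 1)
      ≈ Σg f (+ suc n)
        + ((∑[ M < n ] (ε± 1ℤ  (suc (toℕ M)) * Σg f (+ suc n ℤ.- + suc (toℕ M))))
         + (∑[ M < n ] (ε± -1ℤ (suc (toℕ M)) * Σg f (+ suc n ℤ.- + suc (toℕ M)))))
  ∑aᶠ f n = begin
    ∑[ k ≤ n ] aᶠ f (toℕ k ℕ.+ 1)
      ≈⟨ ∑-cong (suc n) {λ k → aᶠ f (k ℕ.+ 1)} (λ t _ →
           trans (reflexive (cong (aᶠ f) (ℕ.+-comm t 1))) (aᶠ≈ε*g f t)) ⟩
    ∑[ t < suc n ] ∑[ m < suc (toℕ t) ] (ε (toℕ t ℕ.∸ toℕ m) * g f (suc (toℕ m)))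
      ≈⟨ ∑-convolution (suc n) ε (λ m → g f (suc m)) ⟩
    ∑[ M < suc n ] (ε (toℕ M) * Σg f (+ (suc n ℕ.∸ toℕ M)))
      ≈⟨ +-cong (trans (*-congʳ ε[0]≈1) (*-identityˡ (Σg f (+ suc n))))
           (∑-cong n (λ M M<n → trans
             (*-congˡ (reflexive (cong (Σg f) (≡.trans (≡.sym (ℤ.⊖-≥ (ℕ.<⇒≤ M<n)))
               (≡.sym (ℤ.[1+m]⊖[1+n]≡m⊖n n M))))))
             (distribʳ (G M) (ε± 1ℤ (suc M)) (ε± -1ℤ (suc M))))) ⟩
    Σg f (+ suc n) + ∑[ M < n ]
      (ε± 1ℤ (suc (toℕ M)) * G (toℕ M) + ε± -1ℤ (suc (toℕ M)) * G (toℕ M))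
      ≈⟨ +-congˡ (∑-distrib-+ {n} (λ M → ε± 1ℤ (suc (toℕ M)) * G (toℕ M))
                                  (λ M → ε± -1ℤ (suc (toℕ M)) * G (toℕ M))) ⟩
    _ ∎
    where
    G : ℕ → Carrier
    G M = Σg f (+ suc n ℤ.- + suc M)

corollary1p5 :
    ∀ {c ℓ : Level} (R : CommutativeRing c ℓ) →
    let open CommutativeRing R
        open Lambert R
    in
    (f : Arith) (n : ℕ) → n ℕ.≥ 1 →
    Σg f (+ (n ℕ.+ 1))
      ≈ (∑[ b ≡±1] ∑[ k ∈1⋯ ⌊[√ 24 ℕ.* n ℕ.+ 1 - b ]/6⌋ ℤ.+ 1ℤ ]
           -1^ (+ (k ℕ.+ 1)) * Σg f (+ (n ℕ.+ 1) ℤ.- pentagonal b k))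
        + (∑[ k ≤ n ] aᶠ f (toℕ k ℕ.+ 1))
corollary1p5 R f n _ = subst
    (λ X → Σg f (+ X)
      ≈ (∑[ b ≡±1] ∑[ k ∈1⋯ ⌊[√ 24 ℕ.* n ℕ.+ 1 - b ]/6⌋ ℤ.+ 1ℤ ]
           -1^ (+ (k ℕ.+ 1)) * Σg f (+ X ℤ.- pentagonal b k))
        + (∑[ k ≤ n ] aᶠ f (toℕ k ℕ.+ 1)))
    (ℕ.+-comm 1 n) (sym (begin
    _ ≈⟨ +-cong (+-cong (pentagonal-recurrence R plus f n)
                        (pentagonal-recurrence R minus f n)) (∑aᶠ R f n) ⟩
    (- P + - Q) + (S + (P + Q))
      ≈⟨ +-cong (-‿+-comm P Q) (+-comm S (P + Q)) ⟩
    - (P + Q) + ((P + Q) + S)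
      ≈⟨ +-assoc _ _ _ ⟨
    (- (P + Q) + (P + Q)) + S
      ≈⟨ +-congʳ (-‿inverseˡ (P + Q)) ⟩
    0# + S
      ≈⟨ +-identityˡ S ⟩
    S ∎))
  where
  open CommutativeRing R
  open Lambert R
  open import Algebra.Properties.Ring ring using (-‿+-comm)
  open import Relation.Binary.Reasoning.Setoid setoid
  -- The sums over 1 ≤ M ≤ n for b = 1 and b = -1, and the average order at n + 1.
  P Q S : Carrier
  P = ∑[ M < n ] (ε± R 1ℤ  (suc (toℕ M)) * Σg f (+ suc n ℤ.- + suc (toℕ M)))
  Q = ∑[ M < n ] (ε± R -1ℤ (suc (toℕ M)) * Σg f (+ suc n ℤ.- + suc (toℕ M)))
  S = Σg f (+ suc n)
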